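{- There is no (deterministic or randomized) list decodable non-adaptive protocol that robustly simulates the $n$-bit Exchange Protocol for an error rate of $1/2$ with failure probability $o(1)$ and a list size of $2^{n-1}$, regardless of whether the protocol has access to shared randomness, and regardless of whether computationally unbounded protocols that use an arbitrarily large number of rounds and an unbounded alphabet are allowed.
   Context: $n$-bit Exchange Protocol: Alice receives $i_A\in\{0,1\}^n$, Bob receives $i_B\in\{0,1\}^n$, and each party wants to know the other party's string. Communication model. Alice and Bob interact for a fixed number $N$ of rounds over a communication alphabet (of any size). In a non-adaptive protocol, the round number alone determines which one of the two parties transmits, and the other party listens. The transmitted symbol is a function of the transmitting party's private input, the history of communication it has seen and, for randomized protocols, the randomness available to it: its own independent private randomness and, if shared randomness is allowed, a random string known to both parties. The listening party receives the transmitted symbol unless the adversary replaces it by an arbitrary symbol of the alphabet, which counts as one error. The adversary has error rate $\rho$ if it makes at most $\rho N$ errors in total; it knows the protocol but not the (private or shared) randomness. A list decodable protocol with list size $L$ robustly simulates the $n$-bit Exchange Protocol for error rate $\rho$ with failure probability $p$ if, for every pair of inputs and every adversary of error rate $\rho$, with probability at least $1-p$ each of the two parties outputs a list of at most $L$ strings in $\{0,1\}^n$ that contains the other party's input. "No protocol with failure probability $o(1)$" means: there is no sequence of such protocols (with arbitrary $n\ge 1$, numbers of rounds and alphabets) whose failure probabilities tend to $0$. -}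

module Defs where

open import Algebra.Bundles using (CommutativeRing)
import Algebra.Definitions.RawMonoid as RawMonoidDefs
open import Data.Bool.Base using (Bool; if_then_else_)
open import Data.Integer.Base using (+_)
open import Data.List.Base using (List; []; _∷_; length)
open import Data.List.Membership.Propositional using (_∈_)
open import Data.Maybe.Base using (Maybe; fromMaybe; is-just)
open import Data.Nat.Base as ℕ using (ℕ; zero; suc; _≤_)
open import Data.Product.Base using (∃-syntax; Σ-syntax; _×_; _,_)
open import Data.Rational.Base as ℚ using (ℚ)
open import Data.Vec.Base using (Vec)
open import Level using (0ℓ)
import Relation.Binary.Structures as Order
open import Relation.Nullary.Negation.Core using (¬_)
open import Relation.Unary using (Pred; U; ∁; _∩_; _≐_; _⟨×⟩_)

-- Values of probabilities.  There is no type of real numbers to use here,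
-- so probabilities live in an arbitrary ordered ring, with ℝ and ℚ as the
-- intended instances.  The order is not assumed total, because the order of
-- the constructive reals is not.
record OrderedCommutativeRing : Set₁ where
  infix 4 _≲_
  field
    commutativeRing : CommutativeRing 0ℓ 0ℓ
  open CommutativeRing commutativeRing public
  field
    _≲_            : Carrier → Carrier → Set
    isPartialOrder : Order.IsPartialOrder _≈_ _≲_
    +-monoˡ-≲      : ∀ z {x y} → x ≲ y → x + z ≲ y + z
    *-nonNegative  : ∀ {x y} → 0# ≲ x → 0# ≲ y → 0# ≲ x * y
    0≲1            : 0# ≲ 1#
    0≉1            : ¬ (0# ≈ 1#)
  open RawMonoidDefs +-rawMonoid public using () renaming (_×_ to _·_)

module _ (R : OrderedCommutativeRing) where
  open OrderedCommutativeRing R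

  -- p → 0, with 1/(k+1) playing the role of ε:  |p m| ≤ 1/(k+1) eventually.
  TendsToZero : (ℕ → Carrier) → Set
  TendsToZero p =
    ∀ k → ∃[ M ] (∀ m → M ≤ m → (- 1# ≲ suc k · p m) × (suc k · p m ≲ 1#))

  -- A normalised, finitely additive measure on an algebra of subsets of Ω.
  -- Countable additivity is not required, so every probability space in the
  -- usual sense is one of these.  Additivity is stated by splitting A along
  -- B, which, unlike additivity over disjoint unions, does not need B to be
  -- decidable in order to be useful; classically the two agree.
  record Probability (Ω : Set) : Set₁ where
    field
      Event      : Pred Ω 0ℓ → Set
      event-resp : ∀ {A B} → A ≐ B → Event A → Event B
      event-U    : Event U
      event-∁    : ∀ {A} → Event A → Event (∁ A)
      event-∩    : ∀ {A B} → Event A → Event B → Event (A ∩ B)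

      ℙ         : ∀ {A} → Event A → Carrier
      ℙ-cong    : ∀ {A B} → A ≐ B → (a : Event A) (b : Event B) → ℙ a ≈ ℙ b
      ℙ-nonNeg  : ∀ {A} (a : Event A) → 0# ≲ ℙ a
      ℙ-U       : ℙ event-U ≈ 1#
      ℙ-split   : ∀ {A B} (a : Event A) (b : Event B) →
                  ℙ a ≈ ℙ (event-∩ a b) + ℙ (event-∩ a (event-∁ b))

  -- A joint law under which the three coordinates are independent.
  record IndependentLaw {X Y Z : Set} (PX : Probability X)
                        (PY : Probability Y) (PZ : Probability Z) : Set₁ where
    private
      module X = Probability PX
      module Y = Probability PY
      module Z = Probability PZ
    field
      law : Probability (X × Y × Z)
    open Probability law public
    field
      rectangle   : ∀ {A B C} → X.Event A → Y.Event B → Z.Event C →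
                    Event (A ⟨×⟩ B ⟨×⟩ C)
      independent : ∀ {A B C} (a : X.Event A) (b : Y.Event B) (c : Z.Event C) →
                    ℙ (rectangle a b c) ≈ X.ℙ a * Y.ℙ b * Z.ℙ c

data Party : Set where
  alice bob : Party

other : Party → Party
other alice = bob
other bob   = alice

BitString : ℕ → Set
BitString = Vec Bool

-- Every list of symbols below is a history with the most recent symbol
-- first, so its length is the number of rounds already played.

-- Given the symbols transmitted in earlier rounds and the one being
-- transmitted now, the adversary lets the latter through (nothing) or
-- replaces it (just).  What it did earlier is determined by the former.
Adversary : Set → Set
Adversary Symbol = (earlier : List Symbol) (now : Symbol) → Maybe Symbol

-- A non-adaptive protocol, all of whose decisions may depend on randomness
-- except who speaks in a given round.  Protocols without shared randomness
-- have Shared = ⊤, and deterministic ones moreover have Private x = ⊤.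
record Protocol (R : OrderedCommutativeRing) (n : ℕ) : Set₁ where
  field
    rounds  : ℕ
    Symbol  : Set
    speaker : ℕ → Party     -- only the values at 0, …, rounds - 1 matter

    Private     : Party → Set
    Shared      : Set
    privateProb : ∀ x → Probability R (Private x)
    sharedProb  : Probability R Shared
    coins       : IndependentLaw R (privateProb alice) (privateProb bob) sharedProb

    -- The history seen by a party consists of its own symbols as it sent
    -- them and the other party's symbols as they were delivered.
    transmit : ∀ x → BitString n → Private x → Shared → List Symbol → Symbol
    output   : ∀ x → BitString n → Private x → Shared → List Symbol →
               List (BitString n)

  Coins : Set
  Coins = Private alice × Private bob × Shared

  own : ∀ x → Coins → Private x
  own alice (a , _ , _) = a
  own bob   (_ , b , _) = b

  shared : Coins → Shared
  shared (_ , _ , s) = s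

record State (Symbol : Set) : Set where
  constructor ⟨_,_,_⟩
  field
    seen   : Party → List Symbol
    sent   : List Symbol           -- as transmitted, before any corruption
    errors : ℕ

module _ {R : OrderedCommutativeRing} {n : ℕ} (π : Protocol R n) where
  open OrderedCommutativeRing R using (Carrier; _≲_; _-_; 1#)
  open Protocol π
  open State

  received : (speaks listens : Party) → Symbol → Maybe Symbol → Symbol
  received alice alice s r = s
  received alice bob   s r = fromMaybe s r
  received bob   alice s r = fromMaybe s r
  received bob   bob   s r = s

  step : Party → Symbol → Maybe Symbol → State Symbol → State Symbol
  step x s r st = ⟨ (λ y → received x y s r ∷ seen st y)
                  , s ∷ sent st
                  , (if is-just r then suc (errors st) else errors st) ⟩

  run : Adversary Symbol → (Party → BitString n) → Coins → ℕ → State Symbol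
  run adv input ω zero    = ⟨ (λ _ → []) , [] , 0 ⟩
  run adv input ω (suc r) = step x s (adv (sent st) s) st
    where
    st = run adv input ω r
    x  = speaker r
    s  = transmit x (input x) (own x ω) (shared ω) (seen st x)

  HasErrorRate : ℚ → Adversary Symbol → Set
  HasErrorRate ρ adv = ∀ input ω →
    (+ errors (run adv input ω rounds)) ℚ./ 1 ℚ.≤ ρ ℚ.* ((+ rounds) ℚ./ 1)

  decoded : Adversary Symbol → (Party → BitString n) → Coins → Party →
            List (BitString n)
  decoded adv input ω x =
    output x (input x) (own x ω) (shared ω) (seen (run adv input ω rounds) x)

  Success : ℕ → Adversary Symbol → (Party → BitString n) → Pred Coins 0ℓ
  Success L adv input ω = ∀ x →
    (length (decoded adv input ω x) ≤ L) ×
    (input (other x) ∈ decoded adv input ω x)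

  RobustlySimulatesExchange : (ρ : ℚ) (p : Carrier) (L : ℕ) → Set
  RobustlySimulatesExchange ρ p L = ∀ input adv → HasErrorRate ρ adv →
    Σ[ e ∈ Event (Success L adv input) ] (1# - p ≲ ℙ e)
    where open IndependentLaw coins using (Event; ℙ)

-- Some party, say Alice, speaks in at most half of the rounds, so an adversary
-- of error rate 1/2 can afford to replace everything she says by one fixed
-- symbol.  Bob's list then depends on his input and the coins only, so for fixed
-- coins it contains at most 2ⁿ⁻¹ of Alice's 2ⁿ possible inputs.  Averaging over
-- the coins, the success probabilities for these inputs add up to at most 2ⁿ⁻¹,
-- whence 2ⁿ (1 - p) ≤ 2ⁿ⁻¹, which is impossible once 3 p ≤ 1.

module Submission where

open import Defs
import Algebra.Bundles
import Algebra.Properties.CommutativeMonoid.Mult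
import Algebra.Properties.CommutativeSemigroup
open import Data.Bool.Base using (true; false; if_then_else_)
open import Data.Empty using (⊥-elim)
open import Data.Integer.Base using (+_; +≤+)
import Data.Integer.Base as ℤ
import Data.Integer.Properties as ℤ
open import Data.List.Base using (List; []; _∷_; length; foldr; cartesianProductWith; map)
open import Data.List.Membership.Propositional using (_∈_)
open import Data.List.Properties using (length-++; length-map; length-removeAt′)
open import Data.List.Relation.Unary.All using ([]; _∷_)
import Data.List.Relation.Unary.All as All
open import Data.List.Relation.Unary.AllPairs using ([]; _∷_)
open import Data.List.Relation.Unary.Any using (here; there; index; _─_)
open import Data.List.Relation.Unary.Unique.Propositional using (Unique)
open import Data.List.Relation.Unary.Unique.Propositional.Properties using (cartesianProductWith⁺)
open import Data.Maybe.Base using (just; nothing)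
open import Data.Nat.Base as ℕ using (ℕ; zero; suc; _≤_; z≤n; s≤s; _^_; _∸_)
import Data.Nat.Properties as ℕ
open import Data.Nat.Tactic.RingSolver using (solve-∀)
open import Data.Product.Base using (Σ-syntax; ∃-syntax; _×_; _,_; proj₁; proj₂)
open import Data.Rational.Base as ℚ using (½)
import Data.Rational.Properties as ℚ
open import Data.Rational.Unnormalised.Base as ℚᵘ using (mkℚᵘ; *≤*)
import Data.Rational.Unnormalised.Properties as ℚᵘ
open import Data.Sum.Base using (inj₁; inj₂)
open import Data.Vec.Base using ([]; _∷_; replicate)
open import Data.Vec.Properties using (∷-injective)
open import Level using (0ℓ)
open import Relation.Binary.Bundles using (Poset)
open import Relation.Binary.Definitions using (DecidableEquality)
open import Relation.Binary.PropositionalEquality as ≡ using (_≡_; _≢_; refl; cong; cong₂)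
import Relation.Binary.Reasoning.PartialOrder
open import Relation.Nullary.Decidable.Core using (yes; no; does)
open import Relation.Nullary.Negation.Core using (¬_; contradiction)
open import Relation.Unary using (Pred; U; ∁; _∩_; _≐_)

-- Inequalities and finite sums in a partially ordered commutative ring.

module OrderedRingProperties (R : OrderedCommutativeRing) where
  open OrderedCommutativeRing R hiding (zero)
    renaming (refl to ≈-refl; sym to ≈-sym; trans to ≈-trans)
  open Algebra.Properties.CommutativeMonoid.Mult +-commutativeMonoid public
    using (×-congʳ; ×-congˡ; ×-homo-+; ×-assocˡ; ×-distrib-+)

  open Algebra.Properties.CommutativeSemigroup
    (Algebra.Bundles.CommutativeMonoid.commutativeSemigroup +-commutativeMonoid)
    using (interchange)

  poset : Poset 0ℓ 0ℓ 0ℓ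
  poset = record { isPartialOrder = isPartialOrder }

  open Poset poset public using ()
    renaming (refl to ≲-refl; trans to ≲-trans; reflexive to ≲-reflexive; antisym to ≲-antisym)
  open Relation.Binary.Reasoning.PartialOrder poset

  +-mono-≲ : ∀ {x y u v} → x ≲ y → u ≲ v → x + u ≲ y + v
  +-mono-≲ {x} {y} {u} {v} x≲y u≲v = begin
    x + u  ≤⟨ +-monoˡ-≲ u x≲y ⟩
    y + u  ≈⟨ +-comm y u ⟩
    u + y  ≤⟨ +-monoˡ-≲ y u≲v ⟩
    v + y  ≈⟨ +-comm v y ⟩
    y + v  ∎

  +-cancelʳ-≲ : ∀ z {x y} → x + z ≲ y + z → x ≲ y
  +-cancelʳ-≲ z {x} {y} x+z≲y+z = begin
    x            ≈⟨ x+z-z≈x x ⟨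
    x + z - z    ≤⟨ +-monoˡ-≲ (- z) x+z≲y+z ⟩
    y + z - z    ≈⟨ x+z-z≈x y ⟩
    y            ∎
    where
    x+z-z≈x : ∀ x → x + z - z ≈ x
    x+z-z≈x x = ≈-trans (+-assoc x z (- z))
                  (≈-trans (+-congˡ (-‿inverseʳ z)) (+-identityʳ x))

  ·-monoʳ-≲ : ∀ k {x y} → x ≲ y → k · x ≲ k · y
  ·-monoʳ-≲ zero    x≲y = ≲-refl
  ·-monoʳ-≲ (suc k) x≲y = +-mono-≲ x≲y (·-monoʳ-≲ k x≲y)

  ·-nonNegative : ∀ k {x} → 0# ≲ x → 0# ≲ k · x
  ·-nonNegative zero    0≲x = ≲-refl
  ·-nonNegative (suc k) 0≲x =
    ≲-trans (≲-reflexive (≈-sym (+-identityˡ 0#))) (+-mono-≲ 0≲x (·-nonNegative k 0≲x))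

  -- All multiples of `1#` are nonnegative, so `1# ≲ suc k · 1#`. Were this at most `0#`,
  -- antisymmetry would identify `0#` and `1#`. The order is not total, so a negated inequality is
  -- all that is claimed.
  [1+k]·1≴0 : ∀ k → ¬ (suc k · 1# ≲ 0#)
  [1+k]·1≴0 k [1+k]·1≲0 = 0≉1 (≲-antisym 0≲1 (begin
    1#             ≈⟨ +-identityʳ 1# ⟨
    1# + 0#        ≤⟨ +-mono-≲ ≲-refl (·-nonNegative k 0≲1) ⟩
    suc k · 1#     ≤⟨ [1+k]·1≲0 ⟩
    0#             ∎))

  x-y+y≈x : ∀ x y → x - y + y ≈ x
  x-y+y≈x x y = ≈-trans (+-assoc x (- y) y)
                  (≈-trans (+-congˡ (-‿inverseˡ y)) (+-identityʳ x))

  2≲3·[1-p] : ∀ {p} → 3 · p ≲ 1# → 2 · 1# ≲ 3 · (1# - p)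
  2≲3·[1-p] {p} 3p≲1 = +-cancelʳ-≲ (3 · p) (begin
    2 · 1# + 3 · p          ≤⟨ +-mono-≲ ≲-refl 3p≲1 ⟩
    2 · 1# + 1#             ≈⟨ +-comm (2 · 1#) 1# ⟩
    3 · 1#                  ≈⟨ ×-congʳ 3 (x-y+y≈x 1# p) ⟨
    3 · (1# - p + p)        ≈⟨ ×-distrib-+ (1# - p) p 3 ⟩
    3 · (1# - p) + 3 · p    ∎)

  -- Multiplying by 3 avoids division: with `K = suc k`, 4K = 2K · 2 ≤ 2K · 3(1 - p) ≤ 3K, and
  -- cancelling 3K leaves K ≤ 0.
  2k·[1-p]≴k : ∀ k {p} → 3 · p ≲ 1# → ¬ ((2 ℕ.* suc k) · (1# - p) ≲ suc k · 1#)
  2k·[1-p]≴k k {p} 3p≲1 2K·[1-p]≲K = [1+k]·1≴0 k (+-cancelʳ-≲ ((3 ℕ.* K) · 1#) (begin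
    K · 1# + (3 ℕ.* K) · 1#           ≈⟨ ×-homo-+ 1# K (3 ℕ.* K) ⟨
    (K ℕ.+ 3 ℕ.* K) · 1#              ≈⟨ ×-congˡ (4K K) ⟩
    (2 ℕ.* K ℕ.* 2) · 1#              ≈⟨ ×-assocˡ 1# (2 ℕ.* K) 2 ⟨
    (2 ℕ.* K) · (2 · 1#)              ≤⟨ ·-monoʳ-≲ (2 ℕ.* K) (2≲3·[1-p] 3p≲1) ⟩
    (2 ℕ.* K) · (3 · (1# - p))        ≈⟨ ×-assocˡ (1# - p) (2 ℕ.* K) 3 ⟩
    (2 ℕ.* K ℕ.* 3) · (1# - p)        ≈⟨ ×-congˡ (ℕ.*-comm (2 ℕ.* K) 3) ⟩
    (3 ℕ.* (2 ℕ.* K)) · (1# - p)      ≈⟨ ×-assocˡ (1# - p) 3 (2 ℕ.* K) ⟨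
    3 · ((2 ℕ.* K) · (1# - p))        ≤⟨ ·-monoʳ-≲ 3 2K·[1-p]≲K ⟩
    3 · (K · 1#)                      ≈⟨ ×-assocˡ 1# 3 K ⟩
    (3 ℕ.* K) · 1#                    ≈⟨ +-identityˡ _ ⟨
    0# + (3 ℕ.* K) · 1#               ∎))
    where
    K = suc k
    4K : ∀ m → m ℕ.+ 3 ℕ.* m ≡ 2 ℕ.* m ℕ.* 2
    4K = solve-∀

  module _ {I : Set} where

    sum : (I → Carrier) → List I → Carrier
    sum f = foldr (λ i s → f i + s) 0#

    sum-cong : ∀ {f g} → (∀ i → f i ≈ g i) → ∀ is → sum f is ≈ sum g is
    sum-cong f≈g []       = ≈-refl
    sum-cong f≈g (i ∷ is) = +-cong (f≈g i) (sum-cong f≈g is)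

    sum-+ : ∀ f g is → sum (λ i → f i + g i) is ≈ sum f is + sum g is
    sum-+ f g []       = ≈-sym (+-identityˡ 0#)
    sum-+ f g (i ∷ is) = ≈-trans (+-congˡ (sum-+ f g is))
      (interchange (f i) (g i) (sum f is) (sum g is))

    length·≲sum : ∀ {c f} → (∀ i → c ≲ f i) → ∀ is → length is · c ≲ sum f is
    length·≲sum c≲f []       = ≲-refl
    length·≲sum c≲f (i ∷ is) = +-mono-≲ (c≲f i) (length·≲sum c≲f is)

-- Removing one entry from a list.

∈-─⁺ : ∀ {A : Set} {x y : A} {xs} (x∈xs : x ∈ xs) → x ≢ y → y ∈ xs → y ∈ (xs ─ x∈xs)
∈-─⁺ (here refl)  x≢y (here refl)  = contradiction refl x≢y
∈-─⁺ (here _)     x≢y (there y∈xs) = y∈xs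
∈-─⁺ (there _)    x≢y (here refl)  = here refl
∈-─⁺ (there x∈xs) x≢y (there y∈xs) = there (∈-─⁺ x∈xs x≢y y∈xs)

length-─-≤ : ∀ {A : Set} {x : A} {xs k} (x∈xs : x ∈ xs) →
             length xs ≤ suc k → length (xs ─ x∈xs) ≤ k
length-─-≤ {xs = xs} x∈xs ∣xs∣≤1+k =
  ℕ.s≤s⁻¹ (≡.subst (_≤ _) (length-removeAt′ xs (index x∈xs)) ∣xs∣≤1+k)

-- Finitely additive probability and the averaging bound for list decoding.

module ProbabilityProperties (R : OrderedCommutativeRing) {Ω : Set} (P : Probability R Ω) where
  open OrderedCommutativeRing R hiding (zero)
    renaming (refl to ≈-refl; sym to ≈-sym; trans to ≈-trans)
  open OrderedRingProperties R
  open Probability P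
  open Relation.Binary.Reasoning.PartialOrder poset

  -- Splitting `U` along itself gives ℙ(U) = ℙ(U ∩ U) + ℙ(U ∩ ∁ U), and U ∩ U is U, so the last term
  -- cancels to zero.
  ℙ-U∩∁U : ℙ (event-∩ event-U (event-∁ event-U)) ≈ 0#
  ℙ-U∩∁U = ≲-antisym
    (+-cancelʳ-≲ (ℙ event-U) (≲-reflexive (≈-trans (+-comm _ _) (≈-trans
      (+-congʳ (ℙ-cong ((λ _ → _ , _) , proj₁) event-U (event-∩ event-U event-U)))
      (≈-trans (≈-sym (ℙ-split event-U event-U)) (≈-sym (+-identityˡ _)))))))
    (ℙ-nonNeg _)

  ℙ-empty : ∀ {A} (a : Event A) → (∀ ω → ¬ A ω) → ℙ a ≈ 0#
  ℙ-empty a ¬A = ≈-trans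
    (ℙ-cong ((λ {ω} Aω → ⊥-elim (¬A ω Aω)) , λ {ω} (u , ¬u) → ⊥-elim (¬u u)) a _)
    ℙ-U∩∁U

  -- On an empty space `U` is an empty event, so its probability would be both 0 and 1. No point can
  -- be extracted constructively, but the double negation suffices for deriving a contradiction.
  ¬¬-inhabited : ¬ ¬ Ω
  ¬¬-inhabited ¬Ω = 0≉1 (≈-trans (≈-sym (ℙ-empty event-U (λ ω _ → ¬Ω ω))) ℙ-U)

  module _ {I : Set} {E : I → Pred Ω 0ℓ} (e : ∀ i → Event (E i)) where

    -- Stated by a covering list rather than by counting the `i` with `E i ω`, since `E i` need not
    -- be decidable. The list may depend on `ω` in any way.
    ListDecodable : Pred Ω 0ℓ → List I → ℕ → Set
    ListDecodable A is L = ∀ ω → A ω →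
      ∃[ l ] (length l ≤ L × (∀ {i} → i ∈ is → E i ω → i ∈ l))

    jointProbabilities : ∀ {A} → Event A → I → Carrier
    jointProbabilities a i = ℙ (event-∩ a (e i))

    ℙ-∩-split : ∀ {A} (a : Event A) j i → jointProbabilities a i ≈
      jointProbabilities (event-∩ a (e j)) i + jointProbabilities (event-∩ a (event-∁ (e j))) i
    ℙ-∩-split a j i = ≈-trans (ℙ-split (event-∩ a (e i)) (e j))
      (+-cong (ℙ-cong swap₂₃ _ _) (ℙ-cong swap₂₃ _ _))
      where
      swap₂₃ : ∀ {A B C : Pred Ω 0ℓ} → ((A ∩ B) ∩ C) ≐ ((A ∩ C) ∩ B)
      swap₂₃ = (λ ((x , y) , z) → (x , z) , y) , (λ ((x , y) , z) → (x , z) , y)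

    -- Split along the first event: inside it the list loses one entry.
    sum-ℙ≲list-size : ∀ L {is} → Unique is → ∀ {A} (a : Event A) → ListDecodable A is L →
                      sum (jointProbabilities a) is ≲ L · ℙ a
    sum-ℙ≲list-size L [] a _ = ·-nonNegative L (ℙ-nonNeg a)
    sum-ℙ≲list-size zero {j ∷ is} (_ ∷ is!) {A} a decode = begin
      ℙ (event-∩ a (e j)) + sum (jointProbabilities a) is
        ≤⟨ +-mono-≲ (≲-reflexive (ℙ-empty _ empty))
                    (sum-ℙ≲list-size zero is! a λ ω Aω → let l , ∣l∣≤L , ⊆l = decode ω Aω in
                      l , ∣l∣≤L , λ i∈is → ⊆l (there i∈is)) ⟩
      0# + 0#
        ≈⟨ +-identityˡ 0# ⟩
      0# ∎
      where
      empty : ∀ ω → ¬ (A ∩ E j) ω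
      empty ω (Aω , Ejω) with decode ω Aω
      ... | [] , _ , ⊆l with () ← ⊆l (here refl) Ejω
    sum-ℙ≲list-size (suc L) {j ∷ is} (j∉is ∷ is!) {A} a decode = begin
      ℙ a∩ej + sum (jointProbabilities a) is
        ≈⟨ +-congˡ (≈-trans (sum-cong (ℙ-∩-split a j) is) (sum-+ _ _ is)) ⟩
      ℙ a∩ej + (sum (jointProbabilities a∩ej) is + sum (jointProbabilities a∖ej) is)
        ≤⟨ +-mono-≲ ≲-refl (+-mono-≲ (sum-ℙ≲list-size L is! a∩ej decode-∩)
                                     (sum-ℙ≲list-size (suc L) is! a∖ej decode-∖)) ⟩
      ℙ a∩ej + (L · ℙ a∩ej + suc L · ℙ a∖ej)
        -- `suc L · x` unfolds to `x + L · x`, so the term of `j` itself makes up for the entry lost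
        -- inside `E j`.
        ≈⟨ +-assoc _ _ _ ⟨
      suc L · ℙ a∩ej + suc L · ℙ a∖ej
        ≈⟨ ×-distrib-+ _ _ (suc L) ⟨
      suc L · (ℙ a∩ej + ℙ a∖ej)
        ≈⟨ ×-congʳ (suc L) (ℙ-split a (e j)) ⟨
      suc L · ℙ a ∎
      where
      a∩ej = event-∩ a (e j)
      a∖ej = event-∩ a (event-∁ (e j))

      decode-∩ : ListDecodable (A ∩ E j) is L
      decode-∩ ω (Aω , Ejω) =
        let l , ∣l∣≤1+L , ⊆l = decode ω Aω
            j∈l              = ⊆l (here refl) Ejω
        -- Uniqueness enters here: every remaining `i` differs from `j`, so it survives the removal
        -- of `j` from the list.
        in (l ─ j∈l) , length-─-≤ j∈l ∣l∣≤1+L ,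
           λ i∈is Eiω → ∈-─⁺ j∈l (All.lookup j∉is i∈is) (⊆l (there i∈is) Eiω)

      decode-∖ : ListDecodable (A ∩ ∁ (E j)) is (suc L)
      decode-∖ ω (Aω , _) = let l , ∣l∣≤1+L , ⊆l = decode ω Aω in
        l , ∣l∣≤1+L , λ i∈is → ⊆l (there i∈is)

-- Enumeration of all bit strings.

bitStrings : ∀ n → List (BitString n)
bitStrings zero    = [] ∷ []
bitStrings (suc n) = cartesianProductWith _∷_ (true ∷ false ∷ []) (bitStrings n)

bitStrings-unique : ∀ n → Unique (bitStrings n)
bitStrings-unique zero    = [] ∷ []
bitStrings-unique (suc n) = cartesianProductWith⁺ _∷_ ∷-injective
  (((λ ()) ∷ []) ∷ [] ∷ []) (bitStrings-unique n)

length-cartesianProductWith : ∀ {A B C : Set} (f : A → B → C) xs ys →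
  length (cartesianProductWith f xs ys) ≡ length xs ℕ.* length ys
length-cartesianProductWith f []       ys = refl
length-cartesianProductWith f (x ∷ xs) ys = ≡.trans (length-++ (map (f x) ys))
  (cong₂ ℕ._+_ (length-map (f x) ys) (length-cartesianProductWith f xs ys))

length-bitStrings : ∀ n → length (bitStrings n) ≡ 2 ^ n
length-bitStrings zero    = refl
length-bitStrings (suc n) = ≡.trans
  (length-cartesianProductWith _∷_ (true ∷ false ∷ []) (bitStrings n))
  (cong (2 ℕ.*_) (length-bitStrings n))

-- The parties and the family of inputs to average over.

_≟_ : DecidableEquality Party
alice ≟ alice = yes refl
alice ≟ bob   = no λ ()
bob   ≟ alice = no λ ()
bob   ≟ bob   = yes refl

-- Only the input of the given party varies; the string of zeros for its partner is an arbitrary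
-- fixed choice.
inputs : ∀ {n} → Party → BitString n → Party → BitString n
inputs alice i alice = i
inputs alice i bob   = replicate _ false
inputs bob   i alice = replicate _ false
inputs bob   i bob   = i

-- `Success` at the listener `other x` refers to the input of `other (other x)`, which reduces to
-- `x` only once `x` is known.
inputs-other-other : ∀ {n} x (i : BitString n) → inputs x i (other (other x)) ≡ i
inputs-other-other alice i = refl
inputs-other-other bob   i = refl

inputs-other : ∀ {n} x (i j : BitString n) → inputs x i (other x) ≡ inputs x j (other x)
inputs-other alice i j = refl
inputs-other bob   i j = refl

-- Arithmetic of the error rate 1/2.

2e≤N⇒e≤½N : ∀ e N → 2 ℕ.* e ≤ N → (+ e) ℚ./ 1 ℚ.≤ ½ ℚ.* ((+ N) ℚ./ 1)
2e≤N⇒e≤½N e N 2e≤N = ℚ.toℚᵘ-cancel-≤ (begin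
  ℚ.toℚᵘ ((+ e) ℚ./ 1)                  ≃⟨ ℚ.toℚᵘ-fromℚᵘ (mkℚᵘ (+ e) 0) ⟩
  mkℚᵘ (+ e) 0                          ≤⟨ e≤½N ⟩
  ℚᵘ.½ ℚᵘ.* mkℚᵘ (+ N) 0                ≃⟨ ℚᵘ.*-cong ℚᵘ.≃-refl (ℚ.toℚᵘ-fromℚᵘ (mkℚᵘ (+ N) 0)) ⟨
  ℚᵘ.½ ℚᵘ.* ℚ.toℚᵘ ((+ N) ℚ./ 1)        ≃⟨ ℚ.toℚᵘ-homo-* ½ ((+ N) ℚ./ 1) ⟨
  ℚ.toℚᵘ (½ ℚ.* ((+ N) ℚ./ 1))          ∎)
  where
  open ℚᵘ.≤-Reasoning
  e≤½N : mkℚᵘ (+ e) 0 ℚᵘ.≤ ℚᵘ.½ ℚᵘ.* mkℚᵘ (+ N) 0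
  -- For unnormalised fractions the order is cross multiplication, here e · 2 ≤ (1 · N) · 1 over the
  -- integers.
  e≤½N = *≤* (≡.subst₂ ℤ._≤_ (ℤ.pos-* e 2)
    (≡.sym (≡.trans (ℤ.*-identityʳ _) (ℤ.*-identityˡ (+ N))))
    (+≤+ (≡.subst (_≤ N) (ℕ.*-comm 2 e) 2e≤N)))

2m≤m+n : ∀ {m n} → m ≤ n → 2 ℕ.* m ≤ m ℕ.+ n
2m≤m+n {m} m≤n = ℕ.+-monoʳ-≤ m (≡.subst (_≤ _) (≡.sym (ℕ.+-identityʳ m)) m≤n)

-- The jamming adversary and its effect on a protocol.

module _ {R : OrderedCommutativeRing} {n : ℕ} (π : Protocol R n) where
  open Protocol π
  open State

  -- The adversary is not told the round number but recovers it as the length of `earlier`. Since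
  -- the protocol is non-adaptive, this determines who is speaking.
  jam : Party → Symbol → Adversary Symbol
  jam x c earlier _ = if does (speaker (length earlier) ≟ x) then just c else nothing

  turns : Party → ℕ → ℕ
  turns x zero    = 0
  turns x (suc r) = if does (speaker r ≟ x) then suc (turns x r) else turns x r

  turns-alice+bob : ∀ r → turns alice r ℕ.+ turns bob r ≡ r
  turns-alice+bob zero = refl
  turns-alice+bob (suc r) with speaker r
  ... | alice = cong suc (turns-alice+bob r)
  ... | bob   = ≡.trans (ℕ.+-suc _ _) (cong suc (turns-alice+bob r))

  quieterParty : ∃[ x ] 2 ℕ.* turns x rounds ≤ rounds
  quieterParty with ℕ.≤-total (turns alice rounds) (turns bob rounds) | turns-alice+bob rounds
  ... | inj₁ a≤b | a+b≡N =
    alice , ≡.subst (2 ℕ.* turns alice rounds ≤_) a+b≡N (2m≤m+n a≤b)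
  ... | inj₂ b≤a | a+b≡N =
    bob , ≡.subst (2 ℕ.* turns bob rounds ≤_)
      (≡.trans (ℕ.+-comm (turns bob rounds) _) a+b≡N) (2m≤m+n b≤a)

  length-sent : ∀ adv input ω r → length (sent (run π adv input ω r)) ≡ r
  length-sent adv input ω zero    = refl
  length-sent adv input ω (suc r) = cong suc (length-sent adv input ω r)

  -- The equality is exact because a replacement counts as an error even when `c` is the symbol that
  -- was transmitted.
  errors-jam : ∀ x c input ω r → errors (run π (jam x c) input ω r) ≡ turns x r
  errors-jam x c input ω zero = refl
  errors-jam x c input ω (suc r)
    rewrite length-sent (jam x c) input ω r with speaker r ≟ x
  ... | yes _ = cong suc (errors-jam x c input ω r)
  ... | no  _ = errors-jam x c input ω r

  jam-errorRate : ∀ x c → 2 ℕ.* turns x rounds ≤ rounds → HasErrorRate π ½ (jam x c)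
  jam-errorRate x c 2t≤N input ω
    rewrite errors-jam x c input ω rounds = 2e≤N⇒e≤½N (turns x rounds) rounds 2t≤N

  -- By induction on the rounds: when `x` speaks, the listener receives `c` in both runs; when the
  -- listener speaks, its symbol depends on its own input, the common coins and a history that
  -- agrees by induction.
  seen-jam : ∀ x c input input′ → input (other x) ≡ input′ (other x) → ∀ ω r →
             seen (run π (jam x c) input ω r) (other x) ≡ seen (run π (jam x c) input′ ω r) (other x)
  seen-jam x c _ _ eq ω zero = refl
  seen-jam x c input input′ eq ω (suc r)
    -- The two runs may have different transcripts, but equal lengths make `jam` consult the same
    -- `speaker r` in both.
    rewrite length-sent (jam x c) input ω r | length-sent (jam x c) input′ ω r
    with x | eq | speaker r | seen-jam x c input input′ eq ω r
  ... | alice | _  | alice | ih = cong (c ∷_) ih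
  ... | bob   | _  | bob   | ih = cong (c ∷_) ih
  ... | alice | eq | bob   | ih = cong₂ _∷_ (cong₂ (λ i h → transmit bob i _ _ h) eq ih) ih
  ... | bob   | eq | alice | ih = cong₂ _∷_ (cong₂ (λ i h → transmit alice i _ _ h) eq ih) ih

  decoded-jam : ∀ x c input input′ → input (other x) ≡ input′ (other x) → ∀ ω →
                decoded π (jam x c) input ω (other x) ≡ decoded π (jam x c) input′ ω (other x)
  decoded-jam x c input input′ eq ω =
    cong₂ (λ i h → output (other x) i _ _ h) eq (seen-jam x c input input′ eq ω rounds)

  module _ {p : OrderedCommutativeRing.Carrier R} {L : ℕ}
           (robust : RobustlySimulatesExchange π ½ p L) (c : Symbol) where
    open OrderedCommutativeRing R using (_·_; _≲_; _-_; 1#)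
    open OrderedRingProperties R
    open IndependentLaw coins
    open ProbabilityProperties R law
    open Relation.Binary.Reasoning.PartialOrder poset

    2^n·[1-p]≲L : (2 ^ n) · (1# - p) ≲ L · 1#
    2^n·[1-p]≲L with quieterParty
    ... | x , 2t≤N = begin
      (2 ^ n) · (1# - p)                               ≈⟨ ×-congˡ (length-bitStrings n) ⟨
      length (bitStrings n) · (1# - p)                 ≤⟨ length·≲sum 1-p≲ (bitStrings n) ⟩
      sum (jointProbabilities success event-U) (bitStrings n)
        ≤⟨ sum-ℙ≲list-size success L (bitStrings-unique n) event-U decode ⟩
      L · ℙ event-U                                    ≈⟨ ×-congʳ L ℙ-U ⟩
      L · 1#                                           ∎
      where
      success : ∀ i → Event (Success π L (jam x c) (inputs x i))
      success i = proj₁ (robust (inputs x i) (jam x c) (jam-errorRate x c 2t≤N))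

      1-p≲ : ∀ i → 1# - p ≲ jointProbabilities success event-U i
      1-p≲ i = ≲-trans (proj₂ (robust (inputs x i) (jam x c) (jam-errorRate x c 2t≤N)))
        (≲-reflexive (ℙ-cong ((λ s → _ , s) , proj₂) _ _))

      -- The zero input of `x` is a mere representative: `decoded-jam` shows that the listener
      -- outputs the same list for every input of `x`.
      list : Coins → List (BitString n)
      list ω = decoded π (jam x c) (inputs x (replicate _ false)) ω (other x)

      list-correct : ∀ {i ω} → Success π L (jam x c) (inputs x i) ω →
                     length (list ω) ≤ L × i ∈ list ω
      list-correct {i} {ω} s
        with ∣l∣≤L , i∈l ← s (other x)
        rewrite inputs-other-other x i
              | decoded-jam x c (inputs x i) (inputs x (replicate _ false)) (inputs-other x _ _) ω
        = ∣l∣≤L , i∈l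

      decode : ListDecodable success U (bitStrings n) L
      decode ω _ with length (list ω) ℕ.≤? L
      ... | yes ∣l∣≤L = list ω , ∣l∣≤L , λ _ s → proj₂ (list-correct s)
      -- An overlong list rules out success for every `i` at these coins, so the empty list covers
      -- all successes.
      ... | no  ∣l∣≰L = [] , z≤n , λ _ s → contradiction (proj₁ (list-correct s)) ∣l∣≰L

lemmaC1 : (R : OrderedCommutativeRing) →
    ¬ (Σ[ n ∈ (ℕ → ℕ) ]
    Σ[ π ∈ (∀ m → Protocol R (n m)) ]
    Σ[ p ∈ (ℕ → OrderedCommutativeRing.Carrier R) ]
    ((∀ m → 1 ≤ n m) ×
    (∀ m → RobustlySimulatesExchange (π m) ½ (p m) (2 ^ (n m ∸ 1))) ×
    TendsToZero R p))
-- The argument 2 stands for the tolerance 1/(2+1), so that 3 p ≤ 1 from the index `M` on.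
lemmaC1 R (n , π , p , 1≤n , robust , p→0) with p→0 2
-- The alphabet has no distinguished symbol to jam with; one is obtained by
-- running the protocol on some coins.
... | M , small = ¬¬-inhabited λ (a , _ , s) →
  impossible (n M) (1≤n M) (proj₂ (small M ℕ.≤-refl))
    (2^n·[1-p]≲L (π M) (robust M) (transmit alice (replicate _ false) a s []))
  where
  open OrderedCommutativeRing R using (_·_; _≲_; _-_; 1#)
  open OrderedRingProperties R using (2k·[1-p]≴k)
  open Protocol (π M) using (transmit; coins)
  open ProbabilityProperties R (IndependentLaw.law coins) using (¬¬-inhabited)

  impossible : ∀ n {p} → 1 ≤ n → 3 · p ≲ 1# → ¬ ((2 ^ n) · (1# - p) ≲ (2 ^ (n ∸ 1)) · 1#)
  -- For a successor exponent, `2 ^ suc n` unfolds to twice `2 ^ n`. Positivity of `2 ^ n` excludes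
  -- the case zero, in which no contradiction would arise.
  impossible (suc n) _ 3p≲1 with 2 ^ n | ℕ.m^n>0 2 n
  ... | suc k | _ = 2k·[1-p]≴k k 3p≲1
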